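{- Let $n,m\in\mathbb{N}$ with $n-1\le m<\binom{n}{2}$, and let $G$ be a connected graph of order $n$ and size $m$. If $I$ is a nondecreasing distance-based topological index, then \[ I(G)\le I(PK_{n,m}). \] If $I$ is a nonincreasing distance-based topological index, then \[ I(G)\ge I(PK_{n,m}). \]
   Context: All graphs are finite and simple. The order of a graph is its number of vertices, and its size is its number of edges. For a connected graph $G$, $d_G(u,v)$ is the usual shortest-path distance. The distance sequence $\mathcal{D}(G)$ of a connected graph $G$ is the nondecreasing sequence (of length $\binom{n}{2}$ if $G$ has order $n$) of the distances between all unordered pairs of distinct vertices of $G$, with repetitions. A topological index $I$, assigning a real number to each connected graph, is distance-based if it can be expressed in the form $I(G)=g(\mathcal{D}(G))$, where $g$ is a real-valued function defined on the set of all finite sequences of positive integers. It is called nondecreasing (nonincreasing) if $g$, when restricted to sequences of any fixed length, is nondecreasing (nonincreasing) in every coordinate. A path-complete graph is a graph obtained from the disjoint union of a path and a complete graph by joining one end of the path to one or more vertices of the complete graph. For given $n,m\in\mathbb{N}$ with $n-1\le m<\binom{n}{2}$ there exists a unique (up to isomorphism) path-complete graph of order $n$ and size $m$; it is denoted $PK_{n,m}$. -}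

module Defs where

open import Data.Bool using (true; false)
open import Data.Fin using (Fin; zero; suc; toℕ; fromℕ; splitAt)
import Data.Fin as Fin
import Data.Fin.Properties as Fin
open import Data.Fin.Subset using (Subset; _∈_; Nonempty; inside; outside; ⊥; ∣_∣)
open import Data.Fin.Subset.Properties using (_∈?_; ∣⊥∣≡0; drop-there)
open import Data.List using (List; []; _∷_; _++_; map; length; filter; allFin; tabulate)
open import Data.List.Properties using (filter-≐; filter-++; length-++; map-tabulate; length-tabulate)
import Data.List.Sort as Sort
open import Data.Nat using (ℕ; zero; suc; _+_; _∸_; _≤_; _<_; z≤n; s≤s; NonZero)
open import Data.Nat.Combinatorics using (_C_; nC1≡n; nCk+nC[k+1]≡[n+1]C[k+1])
open import Data.Nat.Properties
open import Data.Product using (Σ; ∃; ∃₂; ∃-syntax; _×_; _,_; proj₁; proj₂)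
open import Data.Rational as ℚ using (ℚ)
open import Data.Sum using (_⊎_; inj₁; inj₂; swap)
open import Data.Vec using ([]; _∷_; here; there)
open import Function using (_∘_; id; _⇔_; _↔_; Inverse; mk⇔; Equivalence; _on_)
open import Function.Construct.Identity using (↔-id; ⇔-id)
open import Level using (0ℓ)
open import Relation.Binary using (Rel; Symmetric; Irreflexive; Decidable)
import Relation.Binary.Construct.On as On
open import Relation.Binary.PropositionalEquality
open import Relation.Nullary using (¬_; yes; no; does; contradiction)
open import Relation.Nullary.Decidable using (_×-dec_; _⊎-dec_; ¬?; map′)
import Relation.Unary as U

-- Located two-sided Dedekind cuts of ℚ.
record ℝ : Set₁ where
  field
    L U          : ℚ → Set
    L-inhabited  : ∃ L
    U-inhabited  : ∃ U
    L-down       : ∀ {q r} → q ℚ.< r → L r → L q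
    U-up         : ∀ {q r} → q ℚ.< r → U q → U r
    L-open       : ∀ {q} → L q → ∃[ r ] (q ℚ.< r × L r)
    U-open       : ∀ {r} → U r → ∃[ q ] (q ℚ.< r × U q)
    disjoint     : ∀ {q} → L q → ¬ U q
    located      : ∀ {q r} → q ℚ.< r → L q ⊎ U r

infix 4 _≤ᴿ_ _≥ᴿ_ _≃ᴿ_

-- Since the cuts are open, disjoint and located, inclusion of the lower
-- cuts is the same as reverse inclusion of the upper cuts.
_≤ᴿ_ : ℝ → ℝ → Set
x ≤ᴿ y = ∀ q → ℝ.L x q → ℝ.L y q

_≥ᴿ_ : ℝ → ℝ → Set
x ≥ᴿ y = y ≤ᴿ x

_≃ᴿ_ : ℝ → ℝ → Set
x ≃ᴿ y = x ≤ᴿ y × y ≤ᴿ x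

record Graph (n : ℕ) : Set₁ where
  infix 4 _∼_ _∼?_
  field
    _∼_      : Rel (Fin n) 0ℓ
    ∼-sym    : Symmetric _∼_
    ∼-irrefl : Irreflexive _≡_ _∼_
    _∼?_     : Decidable _∼_

-- An unordered pair of distinct vertices is listed once, smaller vertex first.
Pair : ℕ → Set
Pair n = ∃₂ λ (u v : Fin n) → u Fin.< v

sucPair : ∀ {n} → Pair n → Pair (suc n)
sucPair (u , v , u<v) = suc u , suc v , s≤s u<v

pairs : ∀ n → List (Pair n)
pairs zero    = []
pairs (suc n) = map (λ v → zero , suc v , s≤s z≤n) (allFin n) ++ map sucPair (pairs n)

module _ {n} (G : Graph n) where
  open Graph G

  Edge : Pair n → Set
  Edge (u , v , _) = u ∼ v

  edge? : U.Decidable Edge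
  edge? (u , v , _) = u ∼? v

  size : ℕ
  size = length (filter edge? (pairs n))

  data Walk (u : Fin n) : Fin n → ℕ → Set where
    []   : Walk u u 0
    step : ∀ {v w k} → Walk u v k → v ∼ w → Walk u w (suc k)

  -- The null graph is not counted as connected.
  Connected : Set
  Connected = NonZero n × (∀ u v → ∃ (Walk u v))

  walk? : ∀ u v → U.Decidable (Walk u v)
  walk? u v zero    = map′ (λ { refl → [] }) (λ { [] → refl }) (u Fin.≟ v)
  walk? u w (suc k) =
    map′ (λ { (v , p , e) → step p e }) (λ { (step p e) → _ , p , e })
         (Fin.any? λ v → walk? u v k ×-dec (v ∼? w))

record ConnectedGraph (n : ℕ) : Set₁ where
  field
    graph     : Graph n
    connected : Connected graph

open ConnectedGraph public

record _≅_ {m n} (G : Graph m) (H : Graph n) : Set where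
  open Graph G renaming (_∼_ to _∼ᴳ_)
  open Graph H renaming (_∼_ to _∼ᴴ_)
  field
    bijection : Fin m ↔ Fin n
    preserves : ∀ u v → u ∼ᴳ v ⇔ Inverse.to bijection u ∼ᴴ Inverse.to bijection v

Least : (ℕ → Set) → Set
Least P = ∃[ d ] (P d × (∀ {k} → P k → d ≤ k))

least : ∀ {P : ℕ → Set} → U.Decidable P → ∀ k → P k → Least P
least P? zero p = zero , p , λ _ → z≤n
least {P} P? (suc k) p with P? 0
... | yes p₀ = 0 , p₀ , λ _ → z≤n
... | no ¬p₀ with least (P? ∘ suc) k p
...   | d , q , min = suc d , q , lower
  where
  lower : ∀ {j} → P j → suc d ≤ j
  lower {zero}  r = contradiction r ¬p₀
  lower {suc j} r = s≤s (min r)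

ℕ⁺ : Set
ℕ⁺ = Σ ℕ NonZero

module _ {n} (G : ConnectedGraph n) where

  -- A walk of least length is a shortest path.
  shortest : ∀ u v → Least (Walk (graph G) u v)
  shortest u v = let k , w = proj₂ (connected G) u v in least (walk? (graph G) u v) k w

  dist : Fin n → Fin n → ℕ
  dist u v = proj₁ (shortest u v)

  dist-nonZero : ∀ {u v} → u ≢ v → NonZero (dist u v)
  dist-nonZero {u} {v} u≢v with shortest u v
  ... | zero  , [] , _ = contradiction refl u≢v
  ... | suc _ , _  , _ = _

  pairDist : Pair n → ℕ⁺
  pairDist (u , v , u<v) = dist u v , dist-nonZero (Fin.<⇒≢ u<v)

  open Sort (On.decTotalOrder ≤-decTotalOrder (proj₁ {B = NonZero})) using (sort)

  distanceSequence : List ℕ⁺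
  distanceSequence = sort (map pairDist (pairs n))

-- Invariance under isomorphism is not required here: for the
-- distance-based indices below it is automatic.
TopologicalIndex : Set₁
TopologicalIndex = ∀ {n} → ConnectedGraph n → ℝ

_DistanceBasedVia_ : TopologicalIndex → (List ℕ⁺ → ℝ) → Set₁
I DistanceBasedVia g = ∀ {n} (G : ConnectedGraph n) → I G ≃ᴿ g (distanceSequence G)

-- The two lists compared have equal length and differ in one coordinate.
CoordinatewiseNondecreasing : (List ℕ⁺ → ℝ) → Set
CoordinatewiseNondecreasing g =
  ∀ xs ys {a b : ℕ⁺} → proj₁ a ≤ proj₁ b → g (xs ++ a ∷ ys) ≤ᴿ g (xs ++ b ∷ ys)

CoordinatewiseNonincreasing : (List ℕ⁺ → ℝ) → Set
CoordinatewiseNonincreasing g =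
  ∀ xs ys {a b : ℕ⁺} → proj₁ a ≤ proj₁ b → g (xs ++ a ∷ ys) ≥ᴿ g (xs ++ b ∷ ys)

NondecreasingDistanceBased : TopologicalIndex → Set₁
NondecreasingDistanceBased I = ∃[ g ] (I DistanceBasedVia g × CoordinatewiseNondecreasing g)

NonincreasingDistanceBased : TopologicalIndex → Set₁
NonincreasingDistanceBased I = ∃[ g ] (I DistanceBasedVia g × CoordinatewiseNonincreasing g)

-- The path 0 – 1 – ⋯ – p together with the complete graph on Fin c, the
-- end p of the path being joined to the vertices in S.
module _ (p c : ℕ) (S : Subset c) where

  JoinAdj : Rel (Fin (suc p) ⊎ Fin c) 0ℓ
  JoinAdj (inj₁ i) (inj₁ j) = suc (toℕ i) ≡ toℕ j ⊎ suc (toℕ j) ≡ toℕ i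
  JoinAdj (inj₁ i) (inj₂ y) = i ≡ fromℕ p × y ∈ S
  JoinAdj (inj₂ x) (inj₁ j) = j ≡ fromℕ p × x ∈ S
  JoinAdj (inj₂ x) (inj₂ y) = x ≢ y

  joinAdj-sym : Symmetric JoinAdj
  joinAdj-sym {inj₁ i} {inj₁ j} = swap
  joinAdj-sym {inj₁ i} {inj₂ y} = id
  joinAdj-sym {inj₂ x} {inj₁ j} = id
  joinAdj-sym {inj₂ x} {inj₂ y} = _∘ sym

  joinAdj-irrefl : ∀ x → ¬ JoinAdj x x
  joinAdj-irrefl (inj₁ i) (inj₁ e) = 1+n≢n e
  joinAdj-irrefl (inj₁ i) (inj₂ e) = 1+n≢n e
  joinAdj-irrefl (inj₂ x) x≢x      = x≢x refl

  joinAdj? : Decidable JoinAdj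
  joinAdj? (inj₁ i) (inj₁ j) = (suc (toℕ i) ≟ toℕ j) ⊎-dec (suc (toℕ j) ≟ toℕ i)
  joinAdj? (inj₁ i) (inj₂ y) = (i Fin.≟ fromℕ p) ×-dec (y ∈? S)
  joinAdj? (inj₂ x) (inj₁ j) = (j Fin.≟ fromℕ p) ×-dec (x ∈? S)
  joinAdj? (inj₂ x) (inj₂ y) = ¬? (x Fin.≟ y)

  pathComplete : Graph (suc p + c)
  pathComplete = record
    { _∼_      = JoinAdj on splitAt (suc p)
    ; ∼-sym    = λ {u} {v} → joinAdj-sym {splitAt (suc p) u} {splitAt (suc p) v}
    ; ∼-irrefl = λ { {u} refl → joinAdj-irrefl (splitAt (suc p) u) }
    ; _∼?_     = λ u v → joinAdj? (splitAt (suc p) u) (splitAt (suc p) v)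
    }

IsPathComplete : ∀ {n} → Graph n → Set
IsPathComplete G = ∃[ p ] ∃[ c ] Σ (Subset c) λ S → Nonempty S × G ≅ pathComplete p c S

-- "P is PKₙₘ": PKₙₘ is determined up to isomorphism by this property, and
-- PK-exists below shows that such a graph exists whenever n ∸ 1 ≤ m < n C 2.
IsPK : ∀ n m → ConnectedGraph n → Set
IsPK n m P = IsPathComplete (graph P) × size (graph P) ≡ m

module _ {n} {G : Graph n} where
  open Graph G

  infixr 5 _⊕_

  _⊕_ : ∀ {u v w j k} → Walk G u v j → Walk G v w k → ∃ (Walk G u w)
  p ⊕ []       = _ , p
  p ⊕ step q e = _ , step (proj₂ (p ⊕ q)) e

  reverse : ∀ {u v k} → Walk G u v k → ∃ (Walk G v u)
  reverse []         = _ , []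
  reverse (step p e) = step [] (∼-sym e) ⊕ proj₂ (reverse p)

  hub⇒connected : ∀ h → (∀ u → ∃ (Walk G u h)) → ∀ u v → ∃ (Walk G u v)
  hub⇒connected h f u v = proj₂ (f u) ⊕ proj₂ (reverse (proj₂ (f v)))

pathComplete-suc : ∀ p c S (u v : Fin (suc p + c)) →
  Graph._∼_ (pathComplete p c S) u v ⇔ Graph._∼_ (pathComplete (suc p) c S) (suc u) (suc v)
pathComplete-suc p c S u v with splitAt (suc p) u | splitAt (suc p) v
... | inj₁ i | inj₁ j = mk⇔ (λ { (inj₁ e) → inj₁ (cong suc e) ; (inj₂ e) → inj₂ (cong suc e) })
                            (λ { (inj₁ e) → inj₁ (suc-injective e) ; (inj₂ e) → inj₂ (suc-injective e) })
... | inj₁ i | inj₂ y = mk⇔ (λ (e , y∈S) → cong suc e , y∈S) (λ (e , y∈S) → Fin.suc-injective e , y∈S)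
... | inj₂ x | inj₁ j = mk⇔ (λ (e , x∈S) → cong suc e , x∈S) (λ (e , x∈S) → Fin.suc-injective e , x∈S)
... | inj₂ x | inj₂ y = ⇔-id _

pathComplete-zero : ∀ p c S (v : Fin (suc p + c)) →
  Graph._∼_ (pathComplete (suc p) c S) zero (suc v) ⇔ v ≡ zero
pathComplete-zero p c S zero = mk⇔ (λ _ → refl) (λ _ → inj₁ refl)
pathComplete-zero p c S (suc v) with splitAt p v
... | inj₁ i = mk⇔ (λ { (inj₁ ()) ; (inj₂ ()) }) (λ ())
... | inj₂ y = mk⇔ (λ { (() , _) }) (λ ())

module _ (c : ℕ) (S : Subset c) (S≠∅ : Nonempty S) where

  walk-suc : ∀ {p u v k} → Walk (pathComplete p c S) u v k →
             Walk (pathComplete (suc p) c S) (suc u) (suc v) k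
  walk-suc []         = []
  walk-suc {p} (step {v} {w} q e) = step (walk-suc q) (Equivalence.to (pathComplete-suc p c S v w) e)

  walk-to-zero : ∀ p u → ∃ (Walk (pathComplete p c S) u zero)
  walk-to-zero p       zero    = _ , []
  walk-to-zero zero    (suc x) with x ∈? S
  ... | yes x∈S = _ , step [] (refl , x∈S)
  ... | no  x∉S = _ , step (step {v = suc x} {w = suc (proj₁ S≠∅)} []
                             (λ { refl → x∉S (proj₂ S≠∅) }))
                           (refl , proj₂ S≠∅)
  walk-to-zero (suc p) (suc u) =
    _ , step (walk-suc (proj₂ (walk-to-zero p u))) (inj₂ refl)

  pathComplete-connected : ∀ p → Connected (pathComplete p c S)
  pathComplete-connected p = _ , hub⇒connected zero (walk-to-zero p)

count : ∀ {A : Set} {P : A → Set} → U.Decidable P → List A → ℕ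
count P? xs = length (filter P? xs)

count-map : ∀ {A B : Set} {P : B → Set} (P? : U.Decidable P) (f : A → B) xs →
            count P? (map f xs) ≡ count (P? ∘ f) xs
count-map P? f []       = refl
count-map P? f (x ∷ xs) with does (P? (f x))
... | true  = cong suc (count-map P? f xs)
... | false = count-map P? f xs

count-⇔ : ∀ {A : Set} {P Q : A → Set} (P? : U.Decidable P) (Q? : U.Decidable Q) →
          (∀ x → P x ⇔ Q x) → ∀ xs → count P? xs ≡ count Q? xs
count-⇔ P? Q? P⇔Q xs = cong length
  (filter-≐ P? Q? ((λ {x} → Equivalence.to (P⇔Q x)) , (λ {x} → Equivalence.from (P⇔Q x))) xs)

count-allFin-suc : ∀ {n} {P : Fin (suc n) → Set} (P? : U.Decidable P) →
                   count P? (tabulate suc) ≡ count (P? ∘ suc) (allFin n)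
count-allFin-suc P? = trans (cong (count P?) (sym (map-tabulate id suc))) (count-map P? suc (allFin _))

count-∈ : ∀ {c} (S : Subset c) → count (_∈? S) (allFin c) ≡ ∣ S ∣
count-∈ []            = refl
count-∈ (inside ∷ S)  = cong suc (trans (count-allFin-suc (_∈? inside ∷ S))
  (trans (count-⇔ (λ x → suc x ∈? inside ∷ S) (_∈? S) (λ x → mk⇔ drop-there there) (allFin _)) (count-∈ S)))
count-∈ (outside ∷ S) = trans (count-allFin-suc (_∈? outside ∷ S))
  (trans (count-⇔ (λ x → suc x ∈? outside ∷ S) (_∈? S) (λ x → mk⇔ drop-there there) (allFin _)) (count-∈ S))

count-none : ∀ {A : Set} {P : A → Set} (P? : U.Decidable P) → (∀ x → ¬ P x) → ∀ xs → count P? xs ≡ 0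
count-none P? ¬P []       = refl
count-none P? ¬P (x ∷ xs) with P? x
... | yes px = contradiction px (¬P x)
... | no  _  = count-none P? ¬P xs

count-all : ∀ {A : Set} {P : A → Set} (P? : U.Decidable P) → (∀ x → P x) → ∀ xs → count P? xs ≡ length xs
count-all P? all []       = refl
count-all P? all (x ∷ xs) with P? x
... | yes _  = cong suc (count-all P? all xs)
... | no ¬px = contradiction (all x) ¬px

size-suc : ∀ {n} (G : Graph (suc n)) (H : Graph n) →
  (∀ u v → Graph._∼_ H u v ⇔ Graph._∼_ G (suc u) (suc v)) →
  size G ≡ count (λ v → Graph._∼?_ G zero (suc v)) (allFin n) + size H
size-suc {n} G H H⇔G = begin
  count (edge? G) (as ++ bs)                 ≡⟨ cong length (filter-++ (edge? G) as bs) ⟩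
  length (filter (edge? G) as ++ filter (edge? G) bs)
                                             ≡⟨ length-++ (filter (edge? G) as) ⟩
  count (edge? G) as + count (edge? G) bs    ≡⟨ cong₂ _+_ (count-map (edge? G) _ (allFin n))
                                                  (trans (count-map (edge? G) sucPair (pairs n))
                                                         (sym (count-⇔ (edge? H) (edge? G ∘ sucPair)
                                                           (λ (u , v , _) → H⇔G u v) (pairs n)))) ⟩
  count (λ v → Graph._∼?_ G zero (suc v)) (allFin n) + size H ∎
  where
  open ≡-Reasoning
  as bs : List (Pair (suc n))
  as = map (λ v → zero , suc v , s≤s z≤n) (allFin n)
  bs = map sucPair (pairs n)

complete : ∀ n → Graph n
complete n = record
  { _∼_      = _≢_
  ; ∼-sym    = λ u≢v → u≢v ∘ sym
  ; ∼-irrefl = λ u≡v u≢v → u≢v u≡v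
  ; _∼?_     = λ u v → ¬? (u Fin.≟ v)
  }

complete-size : ∀ n → size (complete n) ≡ n C 2
complete-size zero    = refl
complete-size (suc n) = begin
  size (complete (suc n))       ≡⟨ size-suc (complete (suc n)) (complete n)
                                     (λ u v → mk⇔ (λ u≢v → u≢v ∘ Fin.suc-injective) (λ s≢s → s≢s ∘ cong suc)) ⟩
  _ + size (complete n)         ≡⟨ cong₂ _+_ (count-all (λ v → ¬? (zero Fin.≟ suc v)) (λ _ ()) (allFin n)) (complete-size n) ⟩
  length (allFin n) + n C 2     ≡⟨ cong (_+ n C 2) (trans (length-tabulate {n = n} id) (sym (nC1≡n n))) ⟩
  n C 1 + n C 2                 ≡⟨ nCk+nC[k+1]≡[n+1]C[k+1] n 1 ⟩
  suc n C 2                     ∎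
  where open ≡-Reasoning

pathComplete-size : ∀ p c S → size (pathComplete p c S) ≡ p + (∣ S ∣ + c C 2)
pathComplete-size zero c S =
  trans (size-suc (pathComplete zero c S) (complete c) (λ u v → ⇔-id _))
        (cong₂ _+_ (trans (count-⇔ (λ v → Graph._∼?_ (pathComplete zero c S) zero (suc v)) (_∈? S) (λ v → mk⇔ proj₂ (refl ,_)) (allFin c)) (count-∈ S))
                   (complete-size c))
pathComplete-size (suc p) c S =
  trans (size-suc (pathComplete (suc p) c S) (pathComplete p c S) (pathComplete-suc p c S))
        (cong₂ _+_ (trans (count-⇔ (λ v → Graph._∼?_ (pathComplete (suc p) c S) zero (suc v)) (Fin._≟ zero) (pathComplete-zero p c S) (allFin (suc p + c)))
                          (cong suc (trans (count-allFin-suc {p + c} (Fin._≟ zero))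
                                           (count-none (λ v → suc v Fin.≟ zero) (λ _ ()) (allFin (p + c))))))
                   (pathComplete-size p c S))

subsetOfSize : ∀ {s c} → s ≤ c → ∃[ S ] (∣_∣ {c} S ≡ s)
subsetOfSize {c = c} z≤n = ⊥ , ∣⊥∣≡0 c
subsetOfSize (s≤s s≤c) with subsetOfSize s≤c
... | S , eq = inside ∷ S , cong suc eq

∣S∣>0⇒nonempty : ∀ {c} (S : Subset c) → 0 < ∣ S ∣ → Nonempty S
∣S∣>0⇒nonempty (inside  ∷ S) _ = zero , here
∣S∣>0⇒nonempty (outside ∷ S) l with ∣S∣>0⇒nonempty S l
... | x , x∈S = suc x , there x∈S

PK-parameters : ∀ n m → n ∸ 1 ≤ m → m < n C 2 →
  ∃[ p ] ∃[ c ] ∃[ s ] (0 < s × s ≤ c × suc p + c ≡ n × m ≡ p + (s + c C 2))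
PK-parameters (suc (suc k)) (suc m) (s≤s k≤m) m<C with m <? suc k C 2
... | yes m<C′ with PK-parameters (suc k) m k≤m m<C′
...   | p , c , s , 0<s , s≤c , refl , refl = suc p , c , s , 0<s , s≤c , refl , refl
PK-parameters (suc (suc k)) (suc m) (s≤s k≤m) m<C | no m≮C′ =
  0 , suc k , suc m ∸ suc k C 2 , m<n⇒0<n∸m (s≤s C≤m) , bound , refl , sym (m∸n+n≡m (m≤n⇒m≤1+n C≤m))
  where
  C≤m : suc k C 2 ≤ m
  C≤m = ≮⇒≥ m≮C′
  m<sum : suc m < suc k C 2 + suc k
  m<sum = subst (suc m <_)
    (trans (sym (nCk+nC[k+1]≡[n+1]C[k+1] (suc k) 1))
      (trans (cong (_+ suc k C 2) (nC1≡n (suc k))) (+-comm (suc k) (suc k C 2)))) m<C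
  bound : suc m ∸ suc k C 2 ≤ suc k
  bound = m≤n+o⇒m∸n≤o (suc m) (suc k C 2) (<⇒≤ m<sum)

PK-exists : ∀ n m → n ∸ 1 ≤ m → m < n C 2 → ∃[ P ] IsPK n m P
PK-exists n m lo hi with PK-parameters n m lo hi
... | p , c , s , 0<s , s≤c , refl , refl with subsetOfSize s≤c
...   | S , refl = record { graph = pathComplete p c S ; connected = pathComplete-connected c S S≠∅ p }
                 , (p , c , S , S≠∅ , record { bijection = ↔-id _ ; preserves = λ _ _ → ⇔-id _ })
                 , pathComplete-size p c S
  where
  S≠∅ : Nonempty S
  S≠∅ = ∣S∣>0⇒nonempty S 0<s

{-# OPTIONS --safe #-}

-- It suffices to show, for every k ≥ 2, that G has at least as many pairs at
-- distance < k as the path-complete graph P of the same order and size.  The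
-- edges contribute equally, so only the "middle" pairs, those that are not
-- adjacent but at distance < k, have to be compared.  With r = k − 2, the bound
-- Σ_{t<n} min (t − 1, r) separates the two graphs, vertices being added one by one.
--
-- If two vertices a, b of G are at distance ≥ k, start from a geodesic between
-- them and keep adding vertices adjacent to the current set W.  If the new vertex
-- v has a vertex of W at distance e, then by connectedness of W ∪ {v} every
-- distance 2, …, e from v occurs in W, giving min (e − 1, r) middle pairs; and if
-- no vertex of W is at distance ≥ k from v, then every vertex of W that is not
-- adjacent to v counts, and W meets at least k + 1 levels of distance from a,
-- of which v has neighbours on at most three.
--
-- In P, add the vertices in the order of their level along the path.  A new vertex
-- is adjacent to an earlier one, and the levels of its earlier non-neighbours are
-- distinct, so it creates at most min (t − 1, r) middle pairs.

module Submission where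

open import Defs
open import Data.Nat.Properties
open import Algebra.Properties.CommutativeSemigroup +-commutativeSemigroup using (x∙yz≈y∙xz)
open import Data.Fin using (Fin; zero; suc; toℕ; fromℕ; inject₁)
import Data.Fin.Properties as Fin
open import Data.Fin.Subset using (Subset; Nonempty)
open import Data.Fin.Subset.Properties using (_∈?_)
open import Data.List using (List; []; _∷_; _++_; map; length; filter; allFin; tabulate; applyUpTo)
open import Data.List.Membership.Propositional using (_∈_; _∉_; find; lose)
open import Data.List.Membership.Propositional.Properties
  using (∈-∃++; ∈-filter⁺; ∈-filter⁻; ∈-map⁺; ∈-map⁻; ∈-allFin; ∈-applyUpTo⁺; ∈-applyUpTo⁻)
open import Data.List.Properties
  using (++-assoc; filter-++; filter-accept; filter-none; filter-notAll; length-++;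
         length-applyUpTo; length-filter; length-map; length-tabulate; map-tabulate; ++-identityʳ)
open import Data.List.Relation.Binary.Permutation.Propositional as ↭ using (_↭_; ↭-sym; ↭-trans)
import Data.List.Relation.Binary.Permutation.Propositional.Properties as ↭
import Data.List.Relation.Binary.Permutation.Setoid.Properties as Permutationₛ
open import Data.List.Relation.Binary.Pointwise using (Pointwise; []; _∷_)
open import Data.List.Relation.Unary.All as All using (All; []; _∷_)
import Data.List.Relation.Unary.All.Properties as All
open import Data.List.Relation.Unary.AllPairs using (AllPairs; []; _∷_)
import Data.List.Relation.Unary.AllPairs.Properties as AllPairs
open import Data.List.Relation.Unary.Any using (here; there; any?)
open import Data.List.Relation.Unary.Sorted.TotalOrder.Properties using (Sorted⇒AllPairs)
open import Data.List.Relation.Unary.Unique.Propositional using (Unique)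
import Data.List.Relation.Unary.Unique.Propositional.Properties as Unique
import Data.List.Sort as Sort
open import Data.Nat using (ℕ; zero; suc; _+_; _∸_; _⊓_; _≤_; _<_; z≤n; s≤s; NonZero; >-nonZero⁻¹)
open import Data.Nat.Combinatorics using (_C_)
open import Data.Product using (∃₂; ∃-syntax; _×_; _,_; proj₁; proj₂)
open import Data.Sum using (_⊎_; inj₁; inj₂)
open import Function using (_∘_; id; _↔_; Inverse; Equivalence)
open import Function.Construct.Composition using (_↔-∘_)
open import Level using (0ℓ)
open import Relation.Binary using (Rel; Reflexive; Symmetric; Transitive; Decidable; DecTotalOrder)
import Relation.Binary.Construct.Flip.EqAndOrd as Flip
import Relation.Binary.Construct.On as On
open import Relation.Binary.PropositionalEquality
open import Relation.Nullary using (¬_; yes; no; contradiction)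
open import Relation.Nullary.Decidable using (_×-dec_; ¬?)
import Relation.Unary as U

-- Lists without repetition

module _ {A : Set} where

  unique-⊆⇒↭-++ : ∀ {xs ys : List A} → Unique xs → (∀ {x} → x ∈ xs → x ∈ ys) → ∃[ zs ] (ys ↭ xs ++ zs)
  unique-⊆⇒↭-++ {[]}     {ys} _ _ = ys , ↭.↭-refl
  unique-⊆⇒↭-++ {x ∷ xs} (x∉xs ∷ xs!) xs⊆ys with ∈-∃++ (xs⊆ys (here refl))
  ... | as , bs , refl =
    let zs , eq = unique-⊆⇒↭-++ xs! xs⊆as++bs in zs , ↭-trans (↭.shift x as bs) (↭.prep x eq)
    where
    xs⊆as++bs : ∀ {y} → y ∈ xs → y ∈ as ++ bs
    xs⊆as++bs y∈xs with ↭.∈-resp-↭ (↭.shift x as bs) (xs⊆ys (there y∈xs))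
    ... | here refl = contradiction refl (All.lookup x∉xs y∈xs)
    ... | there y∈  = y∈

  unique-⊆⇒length≤ : ∀ {xs ys : List A} → Unique xs → (∀ {x} → x ∈ xs → x ∈ ys) → length xs ≤ length ys
  unique-⊆⇒length≤ {xs} {ys} xs! xs⊆ys with unique-⊆⇒↭-++ xs! xs⊆ys
  ... | zs , eq = begin
    length xs             ≤⟨ m≤m+n (length xs) (length zs) ⟩
    length xs + length zs ≡⟨ length-++ xs ⟨
    length (xs ++ zs)     ≡⟨ ↭.↭-length eq ⟨
    length ys             ∎
    where open ≤-Reasoning

  unique⇒allPairs : ∀ {R : Rel A 0ℓ} {xs} → (∀ {x y} → x ∈ xs → y ∈ xs → x ≢ y → R x y) →
                    Unique xs → AllPairs R xs
  unique⇒allPairs R≢ []           = []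
  unique⇒allPairs R≢ (x∉xs ∷ xs!) =
    All.tabulate (λ y∈ → R≢ (here refl) (there y∈) (All.lookup x∉xs y∈))
    ∷ unique⇒allPairs (λ x∈ y∈ → R≢ (there x∈) (there y∈)) xs!

-- Counting elements and pairs in lists

module _ {A : Set} where

  module _ {P : A → Set} (P? : U.Decidable P) where

    -- Distinct values of `h` come from distinct elements, so it is enough to exhibit the values.
    -- Below, `h` is the distance from a fixed vertex.
    count≥ : ∀ {B : Set} (h : A → B) {ys xs} → Unique ys →
             (∀ {y} → y ∈ ys → ∃[ x ] (x ∈ xs × P x × h x ≡ y)) → length ys ≤ count P? xs
    count≥ h {ys} {xs} ys! f = subst (length ys ≤_) (length-map h (filter P? xs)) (unique-⊆⇒length≤ ys! ys⊆)
      where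
      ys⊆ : ∀ {y} → y ∈ ys → y ∈ map h (filter P? xs)
      ys⊆ y∈ with f y∈
      ... | x , x∈ , px , refl = ∈-map⁺ h (∈-filter⁺ P? x∈ px)

    -- Injectivity is asked only among the elements satisfying `P`. In the application `h` is a
    -- level function, which may repeat values elsewhere.
    count≤ : ∀ {B : Set} (h : A → B) {ys xs} → Unique xs →
             (∀ {x y} → x ∈ xs → y ∈ xs → P x → P y → x ≢ y → h x ≢ h y) →
             (∀ {x} → x ∈ xs → P x → h x ∈ ys) → count P? xs ≤ length ys
    count≤ h {ys} {xs} xs! inj into = subst (_≤ length ys) (length-map h (filter P? xs))
      (unique-⊆⇒length≤ (AllPairs.map⁺ (unique⇒allPairs inj′ (Unique.filter⁺ P? xs!))) ⊆ys)
      where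
      inj′ : ∀ {x y} → x ∈ filter P? xs → y ∈ filter P? xs → x ≢ y → h x ≢ h y
      inj′ x∈ y∈ = 
        let x∈′ , px = ∈-filter⁻ P? x∈
            y∈′ , py = ∈-filter⁻ P? y∈
        in inj x∈′ y∈′ px py
      ⊆ys : ∀ {y} → y ∈ map h (filter P? xs) → y ∈ ys
      ⊆ys y∈ with ∈-map⁻ h y∈
      ... | x , x∈ , refl = let x∈′ , px = ∈-filter⁻ P? x∈ in into x∈′ px

    count-accept : ∀ {x xs} → P x → count P? (x ∷ xs) ≡ suc (count P? xs)
    count-accept px = cong length (filter-accept P? px)

    count-↭ : ∀ {xs ys} → xs ↭ ys → count P? xs ≡ count P? ys
    count-↭ = ↭.↭-length ∘ ↭.filter-↭ P?

  count-split : ∀ {P Q : A → Set} (P? : U.Decidable P) (Q? : U.Decidable Q) → (∀ x → P x → Q x) →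
                ∀ xs → count Q? xs ≡ count P? xs + count (λ x → ¬? (P? x) ×-dec Q? x) xs
  count-split P? Q? P⊆Q [] = refl
  count-split P? Q? P⊆Q (x ∷ xs) with P? x | Q? x
  ... | yes _ | yes _  = cong suc (count-split P? Q? P⊆Q xs)
  ... | yes p | no ¬q  = contradiction (P⊆Q x p) ¬q
  ... | no _  | yes _  = trans (cong suc (count-split P? Q? P⊆Q xs)) (sym (+-suc _ _))
  ... | no _  | no _   = count-split P? Q? P⊆Q xs

  pairCount : ∀ {R : Rel A 0ℓ} → Decidable R → List A → ℕ
  pairCount R? []       = 0
  pairCount R? (x ∷ xs) = count (R? x) xs + pairCount R? xs

  -- This allows each graph its own order of adding vertices: a list is read with its newest vertex
  -- first, and each vertex is paired with the older ones behind it.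
  pairCount-↭ : ∀ {R : Rel A 0ℓ} (R? : Decidable R) → Symmetric R →
                ∀ {xs ys} → xs ↭ ys → pairCount R? xs ≡ pairCount R? ys
  pairCount-↭ R? R-sym ↭.refl        = refl
  pairCount-↭ R? R-sym (↭.prep x eq) = cong₂ _+_ (count-↭ (R? x) eq) (pairCount-↭ R? R-sym eq)
  pairCount-↭ R? R-sym (↭.trans eq eq′) = trans (pairCount-↭ R? R-sym eq) (pairCount-↭ R? R-sym eq′)
  pairCount-↭ R? R-sym (↭.swap {xs} {ys} x y eq) with R? x y | R? y x
  ... | yes p | no ¬q = contradiction (R-sym p) ¬q
  ... | no ¬p | yes q = contradiction (R-sym q) ¬p
  ... | yes _ | yes _ = cong suc (trans
    (cong₂ _+_ (count-↭ (R? x) eq) (cong₂ _+_ (count-↭ (R? y) eq) (pairCount-↭ R? R-sym eq)))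
    (x∙yz≈y∙xz (count (R? x) ys) (count (R? y) ys) _))
  ... | no _  | no _  = trans
    (cong₂ _+_ (count-↭ (R? x) eq) (cong₂ _+_ (count-↭ (R? y) eq) (pairCount-↭ R? R-sym eq)))
    (x∙yz≈y∙xz (count (R? x) ys) (count (R? y) ys) _)

pairCount-map : ∀ {A B : Set} {R : Rel B 0ℓ} (R? : Decidable R) (f : A → B) xs →
                pairCount R? (map f xs) ≡ pairCount (λ x y → R? (f x) (f y)) xs
pairCount-map R? f []       = refl
pairCount-map R? f (x ∷ xs) = cong₂ _+_ (count-map (R? (f x)) f xs) (pairCount-map R? f xs)

count-pairs : ∀ {n} {R : Rel (Fin n) 0ℓ} (R? : Decidable R) →
              count (λ ((u , v , _) : Pair n) → R? u v) (pairs n) ≡ pairCount R? (allFin n)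
count-pairs {zero}  R? = refl
count-pairs {suc n} R? = begin
  count R₂? (as ++ bs)                 ≡⟨ cong length (filter-++ R₂? as bs) ⟩
  length (filter R₂? as ++ filter R₂? bs) ≡⟨ length-++ (filter R₂? as) ⟩
  count R₂? as + count R₂? bs          ≡⟨ cong₂ _+_ first rest ⟩
  pairCount R? (allFin (suc n))        ∎
  where
  open ≡-Reasoning
  R₂? = λ ((u , v , _) : Pair (suc n)) → R? u v
  as bs : List (Pair (suc n))
  as = map (λ v → zero , suc v , s≤s z≤n) (allFin n)
  bs = map sucPair (pairs n)
  first : count R₂? as ≡ count (R? zero) (tabulate suc)
  first = trans (count-map R₂? _ (allFin n)) (sym (count-allFin-suc (R? zero)))
  rest : count R₂? bs ≡ pairCount R? (tabulate suc)
  rest = begin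
    count R₂? bs                                        ≡⟨ count-map R₂? sucPair (pairs n) ⟩
    count (R₂? ∘ sucPair) (pairs n)                     ≡⟨ count-pairs (λ u v → R? (suc u) (suc v)) ⟩
    pairCount (λ u v → R? (suc u) (suc v)) (allFin n)   ≡⟨ pairCount-map R? suc (allFin n) ⟨
    pairCount R? (map suc (allFin n))                   ≡⟨ cong (pairCount R?) (map-tabulate id suc) ⟩
    pairCount R? (tabulate suc)               ∎

unique⇒↭allFin : ∀ {n} {xs : List (Fin n)} → Unique xs → length xs ≡ n → xs ↭ allFin n
unique⇒↭allFin {n} {xs} xs! len with unique-⊆⇒↭-++ xs! (λ {x} _ → ∈-allFin x)
... | []     , eq = ↭-sym (↭-trans eq (↭.↭-reflexive (++-identityʳ xs)))
... | z ∷ zs , eq = contradiction (begin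
  length xs + suc (length zs) ≡⟨ length-++ xs ⟨
  length (xs ++ z ∷ zs)       ≡⟨ ↭.↭-length eq ⟨
  length (allFin n)           ≡⟨ length-tabulate {n = n} id ⟩
  n                           ≡⟨ len ⟨
  length xs                   ∎) (m+1+n≢m (length xs))
  where open ≡-Reasoning

-- Sorted sequences

module _ {A : Set} (key : A → ℕ) where

  below? : ∀ k → U.Decidable (λ x → key x < k)
  below? k x = key x <? k

  -- If the heads had `key y < key x`, the threshold `suc (key y)` would count `y` but, `x ∷ xs`
  -- being sorted, nothing there. For the tails, a threshold above `key y` counts both heads, and
  -- any other counts nothing in `ys`.
  count-below⇒pointwise : ∀ xs ys → length xs ≡ length ys →
    AllPairs (λ x y → key x ≤ key y) xs → AllPairs (λ x y → key x ≤ key y) ys →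
    (∀ k → count (below? k) ys ≤ count (below? k) xs) → Pointwise (λ x y → key x ≤ key y) xs ys
  count-below⇒pointwise []       []       _   _            _            _     = []
  count-below⇒pointwise (x ∷ xs) (y ∷ ys) len (x≤xs ∷ xs↗) (y≤ys ∷ ys↗) below =
    x≤y ∷ count-below⇒pointwise xs ys (suc-injective len) xs↗ ys↗ tails
    where
    open ≤-Reasoning
    x≤y : key x ≤ key y
    x≤y with key x ≤? key y
    ... | yes le = le
    ... | no ¬le = contradiction (begin
      1                                       ≤⟨ s≤s z≤n ⟩
      suc (count (below? (suc (key y))) ys)   ≡⟨ count-accept (below? (suc (key y))) ≤-refl ⟨
      count (below? (suc (key y))) (y ∷ ys)   ≤⟨ below (suc (key y)) ⟩
      count (below? (suc (key y))) (x ∷ xs)   ≡⟨ cong length (filter-none (below? (suc (key y)))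
                                                   (≤⇒≯ y<x ∷ All.map (λ x≤z → ≤⇒≯ (≤-trans y<x x≤z)) x≤xs)) ⟩
      0                                       ∎) λ ()
      where
      y<x : key y < key x
      y<x = ≰⇒> ¬le
    tails : ∀ k → count (below? k) ys ≤ count (below? k) xs
    tails k with key y <? k
    ... | yes y<k = ≤-pred (begin
      suc (count (below? k) ys) ≡⟨ count-accept (below? k) y<k ⟨
      count (below? k) (y ∷ ys) ≤⟨ below k ⟩
      count (below? k) (x ∷ xs) ≡⟨ count-accept (below? k) (≤-<-trans x≤y y<k) ⟩
      suc (count (below? k) xs) ∎)
    ... | no y≮k = subst (_≤ count (below? k) xs)
      (sym (cong length (filter-none (below? k) (All.map (λ y≤z z<k → y≮k (≤-<-trans y≤z z<k)) y≤ys)))) z≤n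

-- The coordinates are replaced one at a time from the left, and `zs` collects those already done.
-- The preorder is a parameter so that `_≤ᴿ_` and `_≥ᴿ_` are treated together.
coordinatewise⇒pointwise : ∀ {A : Set} {B : Set₁} {R : Rel A 0ℓ} (_≲_ : Rel B 0ℓ) →
  Reflexive _≲_ → Transitive _≲_ →
  (g : List A → B) → (∀ xs ys {a b} → R a b → g (xs ++ a ∷ ys) ≲ g (xs ++ b ∷ ys)) →
  ∀ zs {xs ys} → Pointwise R xs ys → g (zs ++ xs) ≲ g (zs ++ ys)
coordinatewise⇒pointwise _≲_ ≲-refl ≲-trans g mono zs [] = ≲-refl
coordinatewise⇒pointwise _≲_ ≲-refl ≲-trans g mono zs {x ∷ xs} {y ∷ ys} (xRy ∷ xs≤ys) =
  ≲-trans (mono zs xs xRy)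
    (subst₂ (λ us vs → g us ≲ g vs) (++-assoc zs (y ∷ []) xs) (++-assoc zs (y ∷ []) ys)
      (coordinatewise⇒pointwise _≲_ ≲-refl ≲-trans g mono (zs ++ y ∷ []) xs≤ys))

-- Distances

module _ {n} {G : Graph n} where
  open Graph G

  walk-cons : ∀ {u v w k} → u ∼ v → Walk G v w k → Walk G u w (suc k)
  walk-cons e []          = step [] e
  walk-cons e (step p e′) = step (walk-cons e p) e′

  walk-sym : ∀ {u v k} → Walk G u v k → Walk G v u k
  walk-sym []         = []
  walk-sym (step p e) = walk-cons (∼-sym e) (walk-sym p)

  Lipschitz : (Fin n → ℕ) → Set
  Lipschitz h = ∀ {u v} → u ∼ v → h v ≤ suc (h u)

  lipschitz-walk : ∀ {h} → Lipschitz h → ∀ {u v k} → Walk G u v k → h u ≤ k + h v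
  lipschitz-walk         lip []                     = ≤-refl
  lipschitz-walk {h} lip {u} (step {v} {w} {k} p e) = begin
    h u           ≤⟨ lipschitz-walk lip p ⟩
    k + h v       ≤⟨ +-monoʳ-≤ k (lip (∼-sym e)) ⟩
    k + suc (h w) ≡⟨ +-suc k (h w) ⟩
    suc k + h w   ∎
    where open ≤-Reasoning

  -- Applied to membership in the current vertex list, this yields a new vertex with a neighbour in
  -- the list.
  crossing-edge : ∀ {P : Fin n → Set} → U.Decidable P → ∀ {u v k} → Walk G u v k → P u → ¬ P v →
                  ∃₂ λ x y → P x × ¬ P y × x ∼ y
  crossing-edge P? []                 pu ¬pv = contradiction pu ¬pv
  crossing-edge P? (step {x} {y} p e) pu ¬py with P? x
  ... | yes px = x , y , px , ¬py , e
  ... | no ¬px = crossing-edge P? p pu ¬px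

module _ {n} (G : ConnectedGraph n) where
  open Graph (graph G)

  private
    d = dist G

  dist-walk : ∀ u v → Walk (graph G) u v (d u v)
  dist-walk u v = proj₁ (proj₂ (shortest G u v))

  dist-min : ∀ {u v k} → Walk (graph G) u v k → d u v ≤ k
  dist-min {u} {v} = proj₂ (proj₂ (shortest G u v))

  dist-sym : ∀ u v → d u v ≡ d v u
  dist-sym u v = ≤-antisym (dist-min (walk-sym (dist-walk v u))) (dist-min (walk-sym (dist-walk u v)))

  dist-refl : ∀ u → d u u ≡ 0
  dist-refl u = n≤0⇒n≡0 (dist-min [])

  dist-lipschitz : ∀ u → Lipschitz {G = graph G} (d u)
  dist-lipschitz u {v} e = dist-min (step (dist-walk u v) e)

  dist-adjacent : ∀ {u v} → u ∼ v → d u v ≤ 1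
  dist-adjacent e = dist-min (step [] e)

  dist≡0⇒≡ : ∀ {u v} → d u v ≡ 0 → u ≡ v
  dist≡0⇒≡ {u} {v} eq with subst (Walk (graph G) u v) eq (dist-walk u v)
  ... | [] = refl

  predecessor : ∀ {u v j} → d u v ≡ suc j → ∃[ w ] (d u w ≡ j × w ∼ v)
  predecessor {u} {v} {j} eq with subst (Walk (graph G) u v) eq (dist-walk u v)
  ... | step {w} p e = w , ≤-antisym (dist-min p) (≤-pred (subst (_≤ suc (d u w)) eq (dist-lipschitz u e))) , e

  -- For positive `k` this also holds when `u` equals `v`, but it is only counted over pairs from
  -- lists without repetition.
  Mid : ℕ → Rel (Fin n) 0ℓ
  Mid k u v = ¬ u ∼ v × d u v < k

  mid? : ∀ k → Decidable (Mid k)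
  mid? k u v = ¬? (u ∼? v) ×-dec (d u v <? k)

  mid-sym : ∀ k → Symmetric (Mid k)
  mid-sym k {u} {v} (¬e , lt) = ¬e ∘ ∼-sym , subst (_< k) (dist-sym u v) lt

  -- Adjacent vertices are at distance at most 1, below every threshold `2 + r`, so the edges
  -- contribute exactly the size.
  count-below-pairs : ∀ r → count (below? proj₁ (2 + r)) (map (pairDist G) (pairs n)) ≡
                      size (graph G) + pairCount (mid? (2 + r)) (allFin n)
  count-below-pairs r = begin
    count (below? proj₁ (2 + r)) (map (pairDist G) (pairs n))
      ≡⟨ count-map (below? proj₁ (2 + r)) (pairDist G) (pairs n) ⟩
    count (below? proj₁ (2 + r) ∘ pairDist G) (pairs n)
      ≡⟨ count-split (edge? (graph G)) (below? proj₁ (2 + r) ∘ pairDist G)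
           (λ _ e → s≤s (≤-trans (dist-adjacent e) (s≤s z≤n))) (pairs n) ⟩
    size (graph G) + count (λ (u , v , _) → mid? (2 + r) u v) (pairs n)
      ≡⟨ cong (size (graph G) +_) (count-pairs (mid? (2 + r))) ⟩
    size (graph G) + pairCount (mid? (2 + r)) (allFin n) ∎
    where open ≡-Reasoning

-- The summand is the share of a vertex that joins `t` earlier ones. Truncated subtraction makes it
-- 0 for the very first vertex.
triangle : ℕ → ℕ → ℕ
triangle r zero    = 0
triangle r (suc t) = (t ∸ 1) ⊓ r + triangle r t

-- Lower bound for an arbitrary connected graph

module Growing {n} (G : ConnectedGraph n) where
  open Graph (graph G)
  open import Data.List.Membership.DecPropositional (Fin._≟_ {n}) using () renaming (_∈?_ to _∈ᴸ?_)

  private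
    d = dist G

  -- The vertex lists that induce connected subgraphs, presented by an order of construction with
  -- the newest vertex first, which makes induction possible.
  data Grown : List (Fin n) → Set where
    single : ∀ a → Grown (a ∷ [])
    grow   : ∀ {v w W} → w ∈ W → w ∼ v → v ∉ W → Grown W → Grown (v ∷ W)

  grown-unique : ∀ {W} → Grown W → Unique W
  grown-unique (single a)        = [] ∷ []
  grown-unique (grow _ _ v∉W gr) = All.¬Any⇒All¬ _ v∉W ∷ grown-unique gr

  -- Induction on the construction. If the newest vertex `v` is one of the two ends and does not
  -- itself have value `j`, its older neighbour `w` can replace it: `h` changes by at most 1 along
  -- the edge, so `h w` is still on the same side of `j`.
  intermediate-value : ∀ {h} → Lipschitz {G = graph G} h → ∀ {W} → Grown W → ∀ {a b j} → a ∈ W → b ∈ W →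
                       h a ≤ j → j ≤ h b → ∃[ c ] (c ∈ W × h c ≡ j)
  intermediate-value lip (single _) (here refl) (here refl) ha≤j j≤hb = _ , here refl , ≤-antisym ha≤j j≤hb
  intermediate-value lip (grow w∈W e v∉W gr) (there a∈W) (there b∈W) ha≤j j≤hb =
    let c , c∈W , eq = intermediate-value lip gr a∈W b∈W ha≤j j≤hb in c , there c∈W , eq
  intermediate-value lip (grow w∈W e v∉W gr) (here refl) (here refl) ha≤j j≤hb =
    _ , here refl , ≤-antisym ha≤j j≤hb
  intermediate-value {h} lip {v ∷ W} (grow w∈W e v∉W gr) {j = j} (here refl) (there b∈W) ha≤j j≤hb with h v ≟ j
  ... | yes eq  = v , here refl , eq
  ... | no  neq =
    let c , c∈W , eq = intermediate-value lip gr w∈W b∈W (≤-trans (lip (∼-sym e)) (≤∧≢⇒< ha≤j neq)) j≤hb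
    in c , there c∈W , eq
  intermediate-value {h} lip {v ∷ W} (grow w∈W e v∉W gr) {j = j} (there a∈W) (here refl) ha≤j j≤hb with h v ≟ j
  ... | yes eq  = v , here refl , eq
  ... | no  neq =
    let c , c∈W , eq = intermediate-value lip gr a∈W w∈W ha≤j
                         (≤-pred (≤-trans (≤∧≢⇒< j≤hb (neq ∘ sym)) (lip e)))
    in c , there c∈W , eq

  -- On `v ∷ W` the distance from `v` takes all values from 0 to `d v w`. The values 2, ..., `b + 1`
  -- exclude `v` and its neighbours and stay below `2 + r`.
  mids-towards : ∀ r {v w W} → Grown (v ∷ W) → w ∈ W → (d v w ∸ 1) ⊓ r ≤ count (mid? G (2 + r) v) W
  mids-towards r {v} {w} {W} gr w∈W = subst (_≤ count (mid? G (2 + r) v) W) (length-applyUpTo (2 +_) b)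
    (count≥ (mid? G (2 + r) v) (d v) (Unique.applyUpTo⁺₁ (2 +_) b (λ i<j _ → <⇒≢ i<j ∘ +-cancelˡ-≡ 2 _ _)) found)
    where
    b = (d v w ∸ 1) ⊓ r
    found : ∀ {y} → y ∈ applyUpTo (2 +_) b → ∃[ x ] (x ∈ W × Mid G (2 + r) v x × d v x ≡ y)
    found y∈ with ∈-applyUpTo⁻ (2 +_) y∈
    ... | i , i<b , refl
      with intermediate-value (dist-lipschitz G v) gr (here refl) (there w∈W)
             (subst (_≤ 2 + i) (sym (dist-refl G v)) z≤n)
             (<∸1⇒2+≤ (≤-trans i<b (m⊓n≤m (d v w ∸ 1) r)))
      where
      <∸1⇒2+≤ : ∀ {i k} → i < k ∸ 1 → 2 + i ≤ k
      <∸1⇒2+≤ {k = suc k} lt = s≤s lt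
    ...   | x , here refl , eq = contradiction (trans (sym (dist-refl G v)) eq) λ ()
    ...   | x , there x∈W , eq = x , x∈W , (not-adjacent , near) , eq
      where
      not-adjacent : ¬ v ∼ x
      not-adjacent e with subst (_≤ 1) eq (dist-adjacent G e)
      ... | s≤s ()
      near : d v x < 2 + r
      near = subst (_< 2 + r) (sym eq) (+-monoʳ-< 2 (≤-trans i<b (m⊓n≤n (d v w ∸ 1) r)))

  mids-grow : ∀ r {a b v w W} → Grown W → a ∈ W → b ∈ W → 2 + r ≤ d a b → w ∈ W → w ∼ v → v ∉ W →
              r ≤ count (mid? G (2 + r) v) W
  mids-grow r {a} {b} {v} {w} {W} gr a∈W b∈W far w∈W e v∉W with any? (λ u → 2 + r ≤? d v u) W
  -- Here `d v u ∸ 1` is at least `r`, so the minimum in `mids-towards` is `r`.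
  ... | yes any = let u , u∈W , vu-far = find any in
    ≤-trans (≤-reflexive (sym (m≥n⇒m⊓n≡n (≤-trans (n≤1+n r) (∸-monoˡ-≤ 1 vu-far)))))
            (mids-towards r (grow w∈W e v∉W gr) u∈W)
  -- All of `W` is now at distance below `2 + r` from `v`, so only non-adjacency matters. The far
  -- pair `a`, `b` forces `W` to meet the levels 0, ..., `r + 2` of distance from `a`; omitting
  -- three of them leaves `r`.
  ... | no ¬far = subst (_≤ count (mid? G (2 + r) v) W) (length-applyUpTo level r)
    (count≥ (mid? G (2 + r) v) (d a) (Unique.applyUpTo⁺₁ level r (λ {i} {j} i<j _ → <⇒≢ (level-mono i j i<j))) found)
    where
    -- Enumerates the levels above a other than d a v − 1, d a v and d a v + 1.
    level : ℕ → ℕ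
    level i with suc i <? d a v
    ... | yes _ = i
    ... | no  _ = 3 + i
    level-mono : ∀ i j → i < j → level i < level j
    level-mono i j i<j with suc i <? d a v | suc j <? d a v
    ... | yes _ | yes _ = i<j
    ... | yes _ | no  _ = ≤-trans i<j (m≤n+m j 3)
    ... | no ¬p | yes q = contradiction (<-trans (s≤s i<j) q) ¬p
    ... | no _  | no _  = +-monoʳ-< 3 i<j
    level≤ : ∀ i → i < r → level i ≤ 2 + r
    level≤ i i<r with suc i <? d a v
    ... | yes _ = ≤-trans (<⇒≤ i<r) (m≤n+m r 2)
    ... | no  _ = +-monoʳ-≤ 2 i<r
    level-apart : ∀ i x → d a x ≡ level i → ¬ v ∼ x
    level-apart i x eq vx with suc i <? d a v
    ... | yes lt = <⇒≱ lt (subst (λ l → d a v ≤ suc l) eq (dist-lipschitz G a (∼-sym vx)))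
    ... | no ¬lt = ¬lt (≤-pred (subst (_≤ suc (d a v)) eq (dist-lipschitz G a vx)))
    found : ∀ {y} → y ∈ applyUpTo level r → ∃[ x ] (x ∈ W × Mid G (2 + r) v x × d a x ≡ y)
    found y∈ with ∈-applyUpTo⁻ level y∈
    ... | i , i<r , refl
      with intermediate-value (dist-lipschitz G a) gr a∈W b∈W (subst (_≤ level i) (sym (dist-refl G a)) z≤n)
                              (≤-trans (level≤ i i<r) far)
    ...   | x , x∈W , eq = x , x∈W , (level-apart i x eq , ≰⇒> (λ p → ¬far (lose x∈W p))) , eq

  -- The list is a shortest path read backwards from `b` to `a`. The bound on the distances from `a`
  -- guarantees that the next vertex, one step further away, is new.
  geodesic : ∀ r {a} j {b} → d a b ≡ j →
             ∃[ W ] (Grown (b ∷ W) × length W ≡ j × a ∈ b ∷ W × All (λ u → d a u ≤ j) (b ∷ W) ×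
                     triangle r (suc j) ≤ pairCount (mid? G (2 + r)) (b ∷ W))
  geodesic r zero eq with dist≡0⇒≡ G eq
  ... | refl = [] , single _ , refl , here refl , ≤-reflexive eq ∷ [] , z≤n
  geodesic r {a} (suc j) {b} eq with predecessor G eq
  ... | w , aw , e with geodesic r j aw
  ...   | W , gr , len , a∈ , ≤j , tri = w ∷ W , gr′ , cong suc len , there a∈
          , ≤-reflexive eq ∷ All.map m≤n⇒m≤1+n ≤j , +-mono-≤ mids tri
    where
    b∉ : b ∉ w ∷ W
    b∉ b∈ = 1+n≰n (subst (_≤ j) eq (All.lookup ≤j b∈))
    gr′ = grow (here refl) e b∉ gr
    -- Before `b` there are `suc j` vertices, so the summand of `triangle` is `j ⊓ r`; this is what
    -- `mids-towards` gives for `a`, at distance `suc j` from `b`.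
    mids : j ⊓ r ≤ count (mid? G (2 + r) b) (w ∷ W)
    mids = subst (λ l → (l ∸ 1) ⊓ r ≤ count (mid? G (2 + r) b) (w ∷ W)) (trans (dist-sym G b a) eq)
                 (mids-towards r gr′ a∈)

  -- Induction on the number `e` of missing vertices. The far pair stays in `W`, so each addition
  -- creates at least `r` middle pairs, which covers the summand of `triangle`.
  grow-all : ∀ r {a b} e W → e + length W ≡ n → Grown W → a ∈ W → b ∈ W → 2 + r ≤ d a b →
             triangle r (length W) ≤ pairCount (mid? G (2 + r)) W →
             triangle r n ≤ pairCount (mid? G (2 + r)) (allFin n)
  grow-all r zero W len gr a∈W b∈W far tri =
    subst₂ _≤_ (cong (triangle r) len)
      (pairCount-↭ (mid? G (2 + r)) (mid-sym G (2 + r)) (unique⇒↭allFin (grown-unique gr) len)) tri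
  grow-all r {a} (suc e) W len gr a∈W b∈W far tri with Fin.¬∀⟶∃¬ n (_∈ W) (_∈ᴸ? W) not-all
    where
    not-all : ¬ (∀ u → u ∈ W)
    not-all all = <⇒≱ (subst (length W <_) len (s≤s (m≤n+m (length W) e)))
      (subst (_≤ length W) (length-tabulate {n = n} id) (unique-⊆⇒length≤ (Unique.allFin⁺ n) (λ {u} _ → all u)))
  ... | u , u∉W
    -- A walk from `a` to a missing vertex leaves `W` along some edge, whose outer end is added.
    with crossing-edge {G = graph G} {P = _∈ W} (_∈ᴸ? W) (dist-walk G a u) a∈W u∉W
  ...   | w , v , w∈W , v∉W , w∼v =
    grow-all r e (v ∷ W) (trans (+-suc e (length W)) len) (grow w∈W w∼v v∉W gr) (there a∈W) (there b∈W) far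
      (+-mono-≤ (≤-trans (m⊓n≤n (length W ∸ 1) r) (mids-grow r gr a∈W b∈W far w∈W w∼v v∉W)) tri)

  triangle≤mids : ∀ r {a b} → 2 + r ≤ d a b → triangle r n ≤ pairCount (mid? G (2 + r)) (allFin n)
  triangle≤mids r {a} {b} far with geodesic r (d a b) {b} refl
  ... | W , gr , len , a∈ , _ , tri =
    grow-all r (n ∸ suc (length W)) (b ∷ W) (m∸n+n≡m bound) gr a∈ (here refl) far
      (subst (λ t → triangle r (suc t) ≤ pairCount (mid? G (2 + r)) (b ∷ W)) (sym len) tri)
    where
    bound : suc (length W) ≤ n
    bound = subst (suc (length W) ≤_) (length-tabulate {n = n} id)
                  (unique-⊆⇒length≤ (grown-unique gr) (λ {u} _ → ∈-allFin u))

-- Upper bound for path-complete graphs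

-- The properties of path-complete graphs on which the upper bound rests. By `gap`, distinct
-- vertices on equal or consecutive layers are adjacent.
record Layering {n} (G : Graph n) : Set where
  open Graph G
  field
    f         : Fin n → ℕ
    lipschitz : ∀ {u v} → u ∼ v → f v ≤ suc (f u)
    gap       : ∀ {u v} → u ≢ v → ¬ u ∼ v → f u ≤ f v → 2 + f u ≤ f v
    -- Only the top two layers may contain more than one vertex.
    thin      : ∀ {u u′} v → u ≢ u′ → f u ≡ f u′ → f v ≤ suc (f u)
    parent    : ∀ v → 0 < f v → ∃[ u ] (u ∼ v × f u < f v)

module Layered {n} (P : ConnectedGraph n) (L : Layering (graph P)) where
  open Graph (graph P)
  open Layering L

  DownClosed : List (Fin n) → Set
  DownClosed W = ∀ {v u} → v ∈ W → f u < f v → u ∈ W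

  -- On layer 0 the vertex `w` shares the layer of `v`, and `gap` forces adjacency. On a higher
  -- layer the parent of `v` lies strictly below, hence in the list by down-closure.
  adjacent-below : ∀ v w W → v ∉ w ∷ W → f w ≤ f v → DownClosed (v ∷ w ∷ W) → ∃[ u ] (u ∈ w ∷ W × v ∼ u)
  adjacent-below v w W v∉ w≤v down with f v in eq
  ... | zero with v ∼? w
  ...   | yes e = w , here refl , e
  ...   | no ¬e = contradiction (gap (v∉ ∘ here) ¬e (subst (_≤ f w) (sym eq) z≤n))
                    (λ le → contradiction (≤-trans le w≤v) λ ())
  adjacent-below v w W v∉ w≤v down | suc _ with parent v (subst (0 <_) (sym eq) (s≤s z≤n))
  ...   | u , e , lt with down (here refl) lt
  ...     | here refl = contradiction lt (n≮n _)
  ...     | there u∈  = u , u∈ , ∼-sym e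

  -- Two independent bounds: some earlier vertex is adjacent to `v`, and the counted vertices occupy
  -- distinct layers in a window of `r` layers.
  mids-below : ∀ r v W → v ∉ W → Unique W → All (λ w → f w ≤ f v) W → DownClosed (v ∷ W) →
               count (mid? P (2 + r) v) W ≤ (length W ∸ 1) ⊓ r
  mids-below r v W v∉ W! W≤v down = ⊓-glb (not-all W v∉ W≤v down) window
    where
    not-all : ∀ W → v ∉ W → All (λ w → f w ≤ f v) W → DownClosed (v ∷ W) →
              count (mid? P (2 + r) v) W ≤ length W ∸ 1
    not-all []      _  _         _    = z≤n
    not-all (w ∷ W) v∉ (w≤v ∷ _) down with adjacent-below v w W v∉ w≤v down
    ... | u , u∈ , e = ≤-pred (filter-notAll (mid? P (2 + r) v) (w ∷ W) (lose u∈ (λ (¬e , _) → ¬e e)))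
    two-below : ∀ {u} → u ∈ W → Mid P (2 + r) v u → 2 + f u ≤ f v
    two-below u∈ (¬e , _) = gap (λ { refl → v∉ u∈ }) (¬e ∘ ∼-sym) (All.lookup W≤v u∈)
    -- The window is `f v − (r + 1)`, ..., `f v − 2`: `gap` bounds it from above, and distance below
    -- `2 + r` bounds it from below, since layers change by at most 1 along an edge. Two counted
    -- vertices on one layer would contradict `thin`.
    window : count (mid? P (2 + r) v) W ≤ r
    window = subst (count (mid? P (2 + r) v) W ≤_) (length-applyUpTo (λ i → f v ∸ (2 + i)) r)
      (count≤ (mid? P (2 + r) v) f W!
        (λ {x} x∈ y∈ mx _ x≢y eq → <⇒≱ (two-below x∈ mx) (thin v x≢y eq)) into)
      where
      into : ∀ {u} → u ∈ W → Mid P (2 + r) v u → f u ∈ applyUpTo (λ i → f v ∸ (2 + i)) r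
      into {u} u∈ mid@(_ , near) with m≤n⇒∃[o]m+o≡n (two-below u∈ mid)
      ... | i , eq = subst (_∈ applyUpTo (λ i → f v ∸ (2 + i)) r) lower
                       (∈-applyUpTo⁺ (λ i → f v ∸ (2 + i)) (+-cancelˡ-< (2 + f u) i r i<r))
        where
        open ≤-Reasoning
        lower : f v ∸ (2 + i) ≡ f u
        lower = trans (cong (_∸ (2 + i)) (trans (sym eq) (cong (2 +_) (+-comm (f u) i)))) (m+n∸m≡n (2 + i) (f u))
        i<r : 2 + f u + i < 2 + f u + r
        i<r = begin-strict
          2 + f u + i      ≡⟨ eq ⟩
          f v              ≤⟨ lipschitz-walk {h = f} lipschitz (dist-walk P v u) ⟩
          dist P v u + f u <⟨ +-monoˡ-< (f u) near ⟩
          2 + (r + f u)    ≡⟨ cong (2 +_) (+-comm r (f u)) ⟩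
          2 + (f u + r)    ∎

  -- The head has the largest layer, so it lies strictly below no other vertex and removing it
  -- preserves down-closure.
  pairCount≤triangle : ∀ r W → Unique W → AllPairs (λ v w → f w ≤ f v) W → DownClosed W →
                       pairCount (mid? P (2 + r)) W ≤ triangle r (length W)
  pairCount≤triangle r []      _         _          _    = z≤n
  pairCount≤triangle r (v ∷ W) (v≢ ∷ W!) (W≤v ∷ W↘) down =
    +-mono-≤ (mids-below r v W (All.All¬⇒¬Any v≢) W! W≤v down)
             (pairCount≤triangle r W W! W↘ down′)
    where
    down′ : DownClosed W
    down′ w∈ lt with down (there w∈) lt
    ... | here refl = contradiction lt (≤⇒≯ (All.lookup W≤v w∈))
    ... | there u∈  = u∈

  mids≤triangle : ∀ r → pairCount (mid? P (2 + r)) (allFin n) ≤ triangle r n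
  mids≤triangle r = subst₂ _≤_ (pairCount-↭ (mid? P (2 + r)) (mid-sym P (2 + r)) (sort-↭ (allFin n)))
    (cong (triangle r) (trans (↭.↭-length (sort-↭ (allFin n))) (length-tabulate {n = n} id)))
    (pairCount≤triangle r (sort (allFin n))
      (Permutationₛ.Unique-resp-↭ (setoid (Fin n)) (↭.↭⇒↭ₛ (↭-sym (sort-↭ (allFin n)))) (Unique.allFin⁺ n))
      (Sorted⇒AllPairs (DecTotalOrder.totalOrder order) (sort-↗ (allFin n)))
      (λ {_} {u} _ _ → ↭.∈-resp-↭ (↭-sym (sort-↭ (allFin n))) (∈-allFin u)))
    where
    -- Flipped so that layers decrease along the list: the head, read as the vertex added last, is
    -- on the highest layer.
    order = On.decTotalOrder (Flip.decTotalOrder ≤-decTotalOrder) f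
    open Sort order using (sort; sort-↭; sort-↗)

-- The layering of a path-complete graph

module Levels (p c : ℕ) (S : Subset c) where

  -- For nonempty `S` this is the distance from the free end 0 of the path.
  level : Fin (suc p) ⊎ Fin c → ℕ
  level (inj₁ i) = toℕ i
  level (inj₂ y) with y ∈? S
  ... | yes _ = suc p
  ... | no  _ = 2 + p

  level-path≤ : ∀ i → toℕ {suc p} i ≤ p
  level-path≤ i = ≤-pred (Fin.toℕ<n i)

  level-clique≥ : ∀ y → suc p ≤ level (inj₂ y)
  level-clique≥ y with y ∈? S
  ... | yes _ = ≤-refl
  ... | no  _ = n≤1+n (suc p)

  level≤ : ∀ x → level x ≤ 2 + p
  level≤ (inj₁ i) = ≤-trans (level-path≤ i) (m≤n+m p 2)
  level≤ (inj₂ y) with y ∈? S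
  ... | yes _ = n≤1+n (suc p)
  ... | no  _ = ≤-refl

  level-lipschitz : ∀ x y → JoinAdj p c S x y → level y ≤ suc (level x)
  level-lipschitz (inj₁ i) (inj₁ j) (inj₁ e) = ≤-reflexive (sym e)
  level-lipschitz (inj₁ i) (inj₁ j) (inj₂ e) = ≤-trans (n≤1+n (toℕ j)) (≤-trans (≤-reflexive e) (n≤1+n (toℕ i)))
  level-lipschitz (inj₁ i) (inj₂ y) (refl , y∈S) with y ∈? S
  ... | yes _  = s≤s (≤-reflexive (sym (Fin.toℕ-fromℕ p)))
  ... | no y∉S = contradiction y∈S y∉S
  level-lipschitz (inj₂ x) (inj₁ j) _ = ≤-trans (level-path≤ j) (≤-trans (n≤1+n p) (m≤n⇒m≤1+n (level-clique≥ x)))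
  level-lipschitz (inj₂ x) (inj₂ y) _ = ≤-trans (level≤ (inj₂ y)) (s≤s (level-clique≥ x))

  level-gap : ∀ x y → x ≢ y → ¬ JoinAdj p c S x y → level x ≤ level y → 2 + level x ≤ level y
  level-gap (inj₁ i) (inj₁ j) x≢y ¬e i≤j =
    ≤∧≢⇒< (≤∧≢⇒< i≤j (x≢y ∘ cong inj₁ ∘ Fin.toℕ-injective)) (¬e ∘ inj₁)
  level-gap (inj₁ i) (inj₂ y) _ ¬e _ with y ∈? S
  ... | yes y∈S = s≤s (≤∧≢⇒< (level-path≤ i)
                    (λ eq → ¬e (Fin.toℕ-injective (trans eq (sym (Fin.toℕ-fromℕ p))) , y∈S)))
  ... | no  _   = s≤s (s≤s (level-path≤ i))
  level-gap (inj₂ x) (inj₁ j) _   _  le = contradiction (≤-trans (level-clique≥ x) (≤-trans le (level-path≤ j))) 1+n≰n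
  level-gap (inj₂ x) (inj₂ y) x≢y ¬e _  = contradiction (x≢y ∘ cong inj₂) ¬e

  -- Path vertices have distinct levels, all below those of the clique. So two vertices sharing a
  -- level lie in the clique, at level `p + 1` or more, while no level exceeds `p + 2`.
  level-thin : ∀ x x′ y → x ≢ x′ → level x ≡ level x′ → level y ≤ suc (level x)
  level-thin (inj₁ i) (inj₁ j) y x≢x′ eq = contradiction (cong inj₁ (Fin.toℕ-injective eq)) x≢x′
  level-thin (inj₁ i) (inj₂ z) y _    eq = contradiction (subst (_≤ p) eq (level-path≤ i)) (<⇒≱ (level-clique≥ z))
  level-thin (inj₂ z) _        y _    _  = ≤-trans (level≤ y) (s≤s (level-clique≥ z))

  level-parent : Nonempty S → ∀ y → 0 < level y → ∃[ x ] (JoinAdj p c S x y × level x < level y)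
  level-parent _ (inj₁ (suc i)) _ =
    inj₁ (inject₁ i) , inj₁ (cong suc (Fin.toℕ-inject₁ i)) , s≤s (≤-reflexive (Fin.toℕ-inject₁ i))
  level-parent (s , s∈S) (inj₂ y) _ with y ∈? S
  ... | yes y∈S = inj₁ (fromℕ p) , (refl , y∈S) , s≤s (≤-reflexive (Fin.toℕ-fromℕ p))
  ... | no  y∉S = inj₂ s , (λ { refl → y∉S s∈S }) , level-S
    where
    level-S : level (inj₂ s) < 2 + p
    level-S with s ∈? S
    ... | yes _  = ≤-refl
    ... | no s∉S = contradiction s∈S s∉S

pathComplete-mids≤ : ∀ {n} (P : ConnectedGraph n) → IsPathComplete (graph P) →
                     ∀ r → pairCount (mid? P (2 + r)) (allFin n) ≤ triangle r n
pathComplete-mids≤ {n} P (p , c , S , S≠∅ , iso) = Layered.mids≤triangle P record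
  { f         = level ∘ to
  ; lipschitz = λ {u} {v} → level-lipschitz (to u) (to v) ∘ adj
  ; gap       = λ {u} {v} u≢v ¬e → level-gap (to u) (to v) (u≢v ∘ to-injective) (¬e ∘ adj⁻¹)
  ; thin      = λ {u} {u′} v u≢u′ → level-thin (to u) (to u′) (to v) (u≢u′ ∘ to-injective)
  ; parent    = λ v lt → let x , e , x<v = level-parent S≠∅ (to v) lt in
      from x , adj⁻¹ (subst (λ y → JoinAdj p c S y (to v)) (sym (strictlyInverseˡ x)) e)
             , subst (λ y → level y < level (to v)) (sym (strictlyInverseˡ x)) x<v
  }
  where
  open Graph (graph P)
  open Levels p c S
  φ : Fin n ↔ (Fin (suc p) ⊎ Fin c)
  φ = Fin.+↔⊎ ↔-∘ _≅_.bijection iso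
  open Inverse φ using (to; from; strictlyInverseˡ; strictlyInverseʳ)
  to-injective : ∀ {u v} → to u ≡ to v → u ≡ v
  to-injective {u} {v} eq = trans (sym (strictlyInverseʳ u)) (trans (cong from eq) (strictlyInverseʳ v))
  adj : ∀ {u v} → u ∼ v → JoinAdj p c S (to u) (to v)
  adj {u} {v} = Equivalence.to (_≅_.preserves iso u v)
  adj⁻¹ : ∀ {u v} → JoinAdj p c S (to u) (to v) → u ∼ v
  adj⁻¹ {u} {v} = Equivalence.from (_≅_.preserves iso u v)

-- Comparison of the distance sequences

module _ {n} (G P : ConnectedGraph n) (same-size : size (graph G) ≡ size (graph P))
         (pc : IsPathComplete (graph P)) where

  private
    ds : ConnectedGraph n → List ℕ⁺
    ds H = map (pairDist H) (pairs n)

    order = On.decTotalOrder ≤-decTotalOrder (proj₁ {A = ℕ} {B = NonZero})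
    open Sort order using (sort; sort-↭; sort-↗)

  count-below-≤ : ∀ k → count (below? proj₁ k) (ds P) ≤ count (below? proj₁ k) (ds G)
  count-below-≤ 0 = subst (_≤ count (below? proj₁ 0) (ds G))
    (sym (count-none (below? proj₁ 0) (λ _ ()) (ds P))) z≤n
  -- Distances between distinct vertices are positive, so none is below 1.
  count-below-≤ 1 = subst (_≤ count (below? proj₁ 1) (ds G))
    (sym (count-none (below? proj₁ 1) (λ (d , d≢0) d<1 → <⇒≱ (>-nonZero⁻¹ d {{d≢0}}) (≤-pred d<1)) (ds P))) z≤n
  count-below-≤ (suc (suc r)) with Fin.any? (λ a → Fin.any? (λ b → 2 + r ≤? dist G a b))
  ... | yes (a , b , far) = begin
    count (below? proj₁ (2 + r)) (ds P)
      ≡⟨ count-below-pairs P r ⟩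
    size (graph P) + pairCount (mid? P (2 + r)) (allFin n)
      ≤⟨ +-monoʳ-≤ (size (graph P)) (pathComplete-mids≤ P pc r) ⟩
    size (graph P) + triangle r n
      ≡⟨ cong (_+ triangle r n) same-size ⟨
    size (graph G) + triangle r n
      ≤⟨ +-monoʳ-≤ (size (graph G)) (Growing.triangle≤mids G r far) ⟩
    size (graph G) + pairCount (mid? G (2 + r)) (allFin n)
      ≡⟨ count-below-pairs G r ⟨
    count (below? proj₁ (2 + r)) (ds G) ∎
    where open ≤-Reasoning
  -- No distance in `G` reaches `2 + r`, so every pair of `G` is counted and the bound is trivial.
  ... | no ¬far = begin
    count (below? proj₁ (2 + r)) (ds P)
      ≤⟨ length-filter (below? proj₁ (2 + r)) (ds P) ⟩
    length (ds P)
      ≡⟨ length-map (pairDist P) (pairs n) ⟩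
    length (pairs n)
      ≡⟨ count-all (below? proj₁ (2 + r) ∘ pairDist G)
           (λ (u , v , _) → ≰⇒> λ far → ¬far (u , v , far)) (pairs n) ⟨
    count (below? proj₁ (2 + r) ∘ pairDist G) (pairs n)
      ≡⟨ count-map (below? proj₁ (2 + r)) (pairDist G) (pairs n) ⟨
    count (below? proj₁ (2 + r)) (ds G) ∎
    where open ≤-Reasoning

  -- Sorting does not change the counts below a threshold, so `count-below-≤` carries over to the
  -- sorted sequences.
  distanceSequence-≤ : Pointwise (λ x y → proj₁ x ≤ proj₁ y) (distanceSequence G) (distanceSequence P)
  distanceSequence-≤ = count-below⇒pointwise proj₁ (sort (ds G)) (sort (ds P)) same-length (sorted G) (sorted P)
    (λ k → subst₂ _≤_ (sym (count-↭ (below? proj₁ k) (sort-↭ (ds P))))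
                  (sym (count-↭ (below? proj₁ k) (sort-↭ (ds G))))
                  (count-below-≤ k))
    where
    sorted : ∀ H → AllPairs (λ x y → proj₁ x ≤ proj₁ y) (sort (ds H))
    sorted H = Sorted⇒AllPairs (DecTotalOrder.totalOrder order) (sort-↗ (ds H))
    length-sort : ∀ H → length (sort (ds H)) ≡ length (pairs n)
    length-sort H = trans (↭.↭-length (sort-↭ (ds H))) (length-map (pairDist H) (pairs n))
    same-length : length (sort (ds G)) ≡ length (sort (ds P))
    same-length = trans (length-sort G) (sym (length-sort P))

theorem1 : (n m : ℕ) → n ∸ 1 ≤ m → m < n C 2 →
    (G : ConnectedGraph n) → size (graph G) ≡ m →
    (PKₙₘ : ConnectedGraph n) → IsPK n m PKₙₘ →
    (I : TopologicalIndex) →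
    (NondecreasingDistanceBased I → I G ≤ᴿ I PKₙₘ) ×
    (NonincreasingDistanceBased I → I G ≥ᴿ I PKₙₘ)
theorem1 n m _ _ G size-G P (pc , size-P) I =
    (λ (g , via , mono) q → proj₂ (via P) q
       ∘ coordinatewise⇒pointwise _≤ᴿ_ (λ _ → id) (λ r s q → s q ∘ r q) g mono [] D≤ q
       ∘ proj₁ (via G) q)
  -- The same replacement of coordinates for the reversed order: transitivity composes the other way
  -- round, and `via` is used from `P` back to `G`.
  , (λ (g , via , anti) q → proj₂ (via G) q
       ∘ coordinatewise⇒pointwise _≥ᴿ_ (λ _ → id) (λ r s q → r q ∘ s q) g anti [] D≤ q
       ∘ proj₁ (via P) q)
  where
  D≤ : Pointwise (λ x y → proj₁ x ≤ proj₁ y) (distanceSequence G) (distanceSequence P)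
  D≤ = distanceSequence-≤ G P (trans size-G (sym size-P)) pc
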